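{- Let $n$ be a positive integer and let $i, j, k, \ell$ be non-negative integers with $j > \ell$ and $kj + i + \ell < n$. Then the circulant digraph $C_n^{i,j,k,\ell}$ is singular if and only if either $\gcd(\ell+1, n) \ge 2$ or $\gcd\left(k+1, \frac{n}{\gcd(n,j)}\right) \ge 2$.
   Context: An $n \times n$ matrix $A = [a_{uv}]$ is circulant if each row after the first is obtained by cyclically shifting the previous row one position to the right; it is thus determined by its first row. If the first row is $[a_0, a_1, \ldots, a_{n-1}]$, the representer polynomial of $A$ is $\gamma_A(x) = a_0 + a_1 x + \cdots + a_{n-1}x^{n-1}$, so that $A = \gamma_A(W_n)$ where $W_n$ is the circulant matrix with first row $[0,1,0,\ldots,0]$. A digraph (loops allowed) is circulant if its adjacency matrix is circulant, and it is called singular (non-singular) if its adjacency matrix is singular (non-singular). For non-negative integers $i,j,k,\ell$ with $j > \ell$ and $kj+i+\ell < n$, $C_n^{i,j,k,\ell}$ denotes the circulant digraph on $n$ vertices whose adjacency matrix has representer polynomial $$\sum_{t=0}^{k}\sum_{s=i}^{i+\ell} x^{s+tj}.$$ -}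

module Defs where

open import Algebra.Bundles using (Ring)
import Algebra.Properties.Semiring.Sum as Sum
open import Data.Bool.Base using (Bool; true; false; if_then_else_)
open import Data.Fin.Base using (Fin; zero; suc; toℕ; fromℕ<)
import Data.Fin.Properties as Fin
open import Data.Integer.Base using (+_)
open import Data.Nat.Base
open import Data.Nat.DivMod
open import Data.Nat.GCD using (gcd; gcd[m,n]≢0)
open import Data.Nat.Properties
open import Data.Product.Base using (Σ; ∃; _×_; _,_)
open import Data.Rational.Base as ℚ using (ℚ; 0ℚ; 1ℚ)
import Data.Rational.Properties as ℚ
open import Data.Sum.Base using (inj₁)
open import Function.Base using (_∘_)
open import Relation.Binary.PropositionalEquality
open import Relation.Nullary using (¬_; does; yes; no; contradiction)

private
  module ∑ℕ = Sum +-*-semiring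
  module ∑ℚ = Sum (Ring.semiring ℚ.+-*-ring)

Matrix : Set → ℕ → Set
Matrix A n = Fin n → Fin n → A

infix  4 _≈ₘ_
infixl 7 _*ₘ_

_≈ₘ_ : ∀ {n} → Matrix ℚ n → Matrix ℚ n → Set
A ≈ₘ B = ∀ u v → A u v ≡ B u v

1ₘ : ∀ {n} → Matrix ℚ n
1ₘ u v = if does (u Fin.≟ v) then 1ℚ else 0ℚ

_*ₘ_ : ∀ {n} → Matrix ℚ n → Matrix ℚ n → Matrix ℚ n
_*ₘ_ {n} A B u v = ∑[ w < n ] (A u w ℚ.* B w v)
  where open ∑ℚ using (sum-syntax)

-- An integer matrix is invertible over ℚ iff it is over ℝ or ℂ, so
-- working over ℚ loses nothing for adjacency matrices.
Invertible : ∀ {n} → Matrix ℚ n → Set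
Invertible A = ∃ λ B → (A *ₘ B ≈ₘ 1ₘ) × (B *ₘ A ≈ₘ 1ₘ)

SingularMatrix : ∀ {n} → Matrix ℚ n → Set
SingularMatrix A = ¬ Invertible A

-- A polynomial is given by the sequence of its coefficients; finiteness
-- of the support is not enforced.
Poly : Set
Poly = ℕ → ℕ

x^_ : ℕ → Poly
(x^ e) m = if e ≡ᵇ m then 1 else 0

-- Row u′, the one following row u, is row u shifted cyclically one
-- position to the right.
IsCirculant : ∀ {n} .{{_ : NonZero n}} → Matrix ℕ n → Set
IsCirculant {n} A = ∀ {u u′} v → toℕ u′ ≡ suc (toℕ u) →
                    A u′ (suc (toℕ v) mod n) ≡ A u v

representer : ∀ {n} .{{_ : NonZero n}} → Matrix ℕ n → Poly
representer {n} A m with m <? n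
... | yes m<n = A (0 mod n) (fromℕ< m<n)
... | no  _   = 0

Digraph : ℕ → Set
Digraph n = Fin n → Fin n → Bool

adjacency : ∀ {n} → Digraph n → Matrix ℕ n
adjacency D u v = if D u v then 1 else 0

Singular : ∀ {n} → Digraph n → Set
Singular D = SingularMatrix (λ u v → + adjacency D u v ℚ./ 1)

-- The sum over i ≤ s ≤ i + ℓ is reindexed to start at 0.
C-poly : (i j k ℓ : ℕ) → Poly
C-poly i j k ℓ m = ∑[ t ≤ k ] ∑[ s ≤ ℓ ] (x^ (i + toℕ s + toℕ t * j)) m
  where open ∑ℕ using (sum⁺-syntax)

-- The residue of v - u modulo n.
offset : ∀ {n} .{{_ : NonZero n}} → Fin n → Fin n → ℕ
offset {n} u v = (toℕ v + (n ∸ toℕ u)) % n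

-- C-isCirculant and C-representer below show that this is the circulant
-- digraph with representer polynomial C-poly i j k ℓ.
C : (n i j k ℓ : ℕ) .{{_ : NonZero n}} → Digraph n
C n i j k ℓ u v = C-poly i j k ℓ (offset u v) ≡ᵇ 1

C-isCirculant : ∀ n i j k ℓ .{{_ : NonZero n}} →
                IsCirculant (adjacency (C n i j k ℓ))
C-isCirculant n i j k ℓ {u} {u′} v u′≡1+u =
  cong (λ d → if (C-poly i j k ℓ d ≡ᵇ 1) then 1 else 0) offset-eq
  where
  open ≡-Reasoning
  1+u≤n : suc (toℕ u) ≤ n
  1+u≤n = Fin.toℕ<n u

  offset-eq : offset u′ (suc (toℕ v) mod n) ≡ offset u v
  offset-eq = begin
    (toℕ (suc (toℕ v) mod n) + (n ∸ toℕ u′)) % n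
      ≡⟨ cong₂ (λ a b → (a + (n ∸ b)) % n) (Fin.toℕ-fromℕ< _) u′≡1+u ⟩
    (suc (toℕ v) % n + (n ∸ suc (toℕ u))) % n
      ≡⟨ %-distribˡ-+ (suc (toℕ v) % n) _ n ⟩
    (suc (toℕ v) % n % n + (n ∸ suc (toℕ u)) % n) % n
      ≡⟨ cong (λ a → (a + (n ∸ suc (toℕ u)) % n) % n) (m%n%n≡m%n (suc (toℕ v)) n) ⟩
    (suc (toℕ v) % n + (n ∸ suc (toℕ u)) % n) % n
      ≡⟨ %-distribˡ-+ (suc (toℕ v)) _ n ⟨
    (suc (toℕ v) + (n ∸ suc (toℕ u))) % n
      ≡⟨ cong (_% n) (+-suc (toℕ v) _) ⟨
    (toℕ v + suc (n ∸ suc (toℕ u))) % n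
      ≡⟨ cong (λ a → (toℕ v + a) % n) (+-∸-assoc 1 1+u≤n) ⟨
    (toℕ v + (n ∸ toℕ u)) % n ∎

private
  sum≢0 : ∀ {n} (f : Fin n → ℕ) → ∑ℕ.sum f ≢ 0 → ∃ λ x → f x ≢ 0
  sum≢0 {zero}  f ≢0 = contradiction refl ≢0
  sum≢0 {suc n} f ≢0 with f zero ≟ 0
  ... | no  f₀≢0 = zero , f₀≢0
  ... | yes f₀≡0 with sum≢0 (f ∘ suc) (λ s≡0 → ≢0 (cong₂ _+_ f₀≡0 s≡0))
  ...   | x , fx≢0 = suc x , fx≢0

  sum≤1 : ∀ {n} (f : Fin n → ℕ) → (∀ x → f x ≤ 1) →
          (∀ x y → f x ≢ 0 → f y ≢ 0 → x ≡ y) → ∑ℕ.sum f ≤ 1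
  sum≤1 {zero}  f f≤1 uniq = z≤n
  sum≤1 {suc n} f f≤1 uniq with f zero ≟ 0
  ... | yes f₀≡0 rewrite f₀≡0 =
    sum≤1 (f ∘ suc) (f≤1 ∘ suc)
          (λ x y p q → Fin.suc-injective (uniq (suc x) (suc y) p q))
  ... | no f₀≢0 with ∑ℕ.sum (f ∘ suc) ≟ 0
  ...   | yes s≡0 rewrite s≡0 | +-identityʳ (f zero) = f≤1 zero
  ...   | no  s≢0 with sum≢0 (f ∘ suc) s≢0
  ...     | x , fx≢0 = contradiction (uniq zero (suc x) f₀≢0 fx≢0) λ ()

  x^≤1 : ∀ e m → (x^ e) m ≤ 1
  x^≤1 e m with e ≡ᵇ m
  ... | true  = ≤-refl
  ... | false = z≤n

  x^≢0 : ∀ e m → (x^ e) m ≢ 0 → e ≡ m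
  x^≢0 e m ≢0 with e ≡ᵇ m | ≡ᵇ⇒≡ e m
  ... | true  | e≡m = e≡m _
  ... | false | _   = contradiction refl ≢0

  term≢0 : ∀ i j ℓ m t → ∑ℕ.sum {suc ℓ} (λ s → (x^ (i + toℕ s + t * j)) m) ≢ 0 →
           Σ (Fin (suc ℓ)) λ s → i + toℕ s + t * j ≡ m
  term≢0 i j ℓ m t ≢0 with sum≢0 {suc ℓ} _ ≢0
  ... | s , ≢0′ = s , x^≢0 _ m ≢0′

  C-poly≤1 : ∀ i j k ℓ m → ℓ < j → C-poly i j k ℓ m ≤ 1
  C-poly≤1 i j k ℓ m ℓ<j = sum≤1 {suc k} _ inner≤1 outer
    where
    instance
      j≢0 : NonZero j
      j≢0 = >-nonZero (≤-<-trans z≤n ℓ<j)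

    inner≤1 : ∀ (t : Fin (suc k)) →
              ∑ℕ.sum {suc ℓ} (λ s → (x^ (i + toℕ s + toℕ t * j)) m) ≤ 1
    inner≤1 t = sum≤1 {suc ℓ} _ (λ s → x^≤1 (i + toℕ s + toℕ t * j) m) λ s s′ p q →
      Fin.toℕ-injective (+-cancelˡ-≡ i _ _ (+-cancelʳ-≡ (toℕ t * j) _ _
        (trans (x^≢0 _ m p) (sym (x^≢0 _ m q)))))

    %-s : ∀ (s : Fin (suc ℓ)) t → (toℕ s + t * j) % j ≡ toℕ s
    %-s s t = trans ([m+kn]%n≡m%n (toℕ s) t j)
                    (m<n⇒m%n≡m (<-≤-trans (Fin.toℕ<n s) ℓ<j))

    outer : ∀ (t t′ : Fin (suc k)) →
            ∑ℕ.sum {suc ℓ} (λ s → (x^ (i + toℕ s + toℕ t * j)) m) ≢ 0 →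
            ∑ℕ.sum {suc ℓ} (λ s → (x^ (i + toℕ s + toℕ t′ * j)) m) ≢ 0 →
            t ≡ t′
    outer t t′ p q with term≢0 i j ℓ m (toℕ t) p | term≢0 i j ℓ m (toℕ t′) q
    ... | s , e | s′ , e′ = Fin.toℕ-injective (*-cancelʳ-≡ _ _ j t*j≡t′*j)
      where
      eq : toℕ s + toℕ t * j ≡ toℕ s′ + toℕ t′ * j
      eq = +-cancelˡ-≡ i _ _ (trans (sym (+-assoc i (toℕ s) _))
             (trans (trans e (sym e′)) (+-assoc i (toℕ s′) _)))
      s≡s′ : toℕ s ≡ toℕ s′
      s≡s′ = trans (sym (%-s s (toℕ t)))
               (trans (cong (_% j) eq) (%-s s′ (toℕ t′)))
      t*j≡t′*j : toℕ t * j ≡ toℕ t′ * j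
      t*j≡t′*j = +-cancelˡ-≡ (toℕ s) _ _
                   (trans eq (cong (_+ toℕ t′ * j) (sym s≡s′)))

  C-poly-degree : ∀ n i j k ℓ m → k * j + i + ℓ < n → n ≤ m →
                  C-poly i j k ℓ m ≡ 0
  C-poly-degree n i j k ℓ m deg n≤m with C-poly i j k ℓ m ≟ 0
  ... | yes ≡0 = ≡0
  ... | no  ≢0 with sum≢0 {suc k} _ ≢0
  ...   | t , ≢0′ with term≢0 i j ℓ m (toℕ t) ≢0′
  ...     | s , e = contradiction (<-≤-trans deg n≤m) (≤⇒≯ m≤)
    where
    open ≤-Reasoning
    m≤ : m ≤ k * j + i + ℓ
    m≤ = begin
      m                        ≡⟨ e ⟨
      i + toℕ s + toℕ t * j    ≤⟨ +-mono-≤ (+-monoʳ-≤ i (s≤s⁻¹ (Fin.toℕ<n s)))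
                                           (*-monoˡ-≤ j (s≤s⁻¹ (Fin.toℕ<n t))) ⟩
      i + ℓ + k * j            ≡⟨ +-comm (i + ℓ) (k * j) ⟩
      k * j + (i + ℓ)          ≡⟨ +-assoc (k * j) i ℓ ⟨
      k * j + i + ℓ            ∎

  indicator : ∀ {a} → a ≤ 1 → (if a ≡ᵇ 1 then 1 else 0) ≡ a
  indicator z≤n       = refl
  indicator (s≤s z≤n) = refl

C-representer : ∀ n i j k ℓ .{{_ : NonZero n}} → ℓ < j → k * j + i + ℓ < n →
                ∀ m → representer (adjacency (C n i j k ℓ)) m ≡ C-poly i j k ℓ m
C-representer n i j k ℓ ℓ<j deg m with m <? n
... | no  m≮n = sym (C-poly-degree n i j k ℓ m deg (≮⇒≥ m≮n))
... | yes m<n = trans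
  (cong (λ d → if (C-poly i j k ℓ d ≡ᵇ 1) then 1 else 0) offset≡m)
  (indicator (C-poly≤1 i j k ℓ m ℓ<j))
  where
  open ≡-Reasoning
  offset≡m : offset (0 mod n) (fromℕ< m<n) ≡ m
  offset≡m = begin
    (toℕ (fromℕ< m<n) + (n ∸ toℕ (0 mod n))) % n
      ≡⟨ cong₂ (λ a b → (a + (n ∸ b)) % n) (Fin.toℕ-fromℕ< m<n)
               (trans (Fin.toℕ-fromℕ< _) (m<n⇒m%n≡m (>-nonZero⁻¹ n))) ⟩
    (m + n) % n  ≡⟨ [m+n]%n≡m%n m n ⟩
    m % n        ≡⟨ m<n⇒m%n≡m m<n ⟩
    m            ∎

gcd-nonZeroˡ : ∀ m n .{{_ : NonZero m}} → NonZero (gcd m n)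
gcd-nonZeroˡ m n = ≢-nonZero (gcd[m,n]≢0 m n (inj₁ (≢-nonZero⁻¹ m)))

{-# OPTIONS --safe #-}

-- In the ring of circulant matrices, where xⁿ = 1, the adjacency matrix is
-- xⁱ · [k+1](xʲ) · [ℓ+1](x), with [r](y) = 1 + y + ⋯ + yʳ⁻¹. It is therefore
-- enough to decide when [r](y) is a unit, for y = xᵃ.
--
-- If D divides n and ra but not a, then [r](y) kills (1 - y)·(1 + x^D + x^2D + ⋯),
-- which is not zero.
--
-- If y^N = 1 and sr = 1 + qN, put E = [N](y). Then yE = E, so E² = NE, and
-- [s](yʳ)·[r](y) = [1+qN](y) = 1 + qE, whose inverse is 1 - q(1+qN)⁻¹E.

module Submission where

open import Defs
open import Data.Nat.Base using (ℕ; NonZero; suc; _+_; _*_; _/_; _<_; _≥_)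
open import Data.Nat.GCD using (gcd)
open import Data.Sum.Base using (_⊎_)
open import Function.Bundles using (_⇔_)

open import Algebra.Bundles using (Ring)
import Algebra.Properties.Group as Group
import Algebra.Properties.Semiring.Sum as Sum
open import Data.Bool.Base using (true; false; if_then_else_)
open import Data.Fin.Base as Fin using (Fin; zero; toℕ; fromℕ<)
import Data.Fin.Properties as Fin
import Data.Integer.Base as ℤ
import Data.Integer.Properties as ℤ
open import Data.Nat.Base
  using (zero; _∸_; _%_; _≡ᵇ_; _≤_; z≤n; s≤s; s≤s⁻¹)
open import Data.Nat.Coprimality using (Coprime; gcd≡1⇒coprime; coprime-Bézout)
open import Data.Nat.Divisibility
open import Data.Nat.DivMod
open import Data.Nat.GCD
  using (module Bézout; gcd[m,n]∣m; gcd[m,n]∣n; gcd-greatest)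
open import Data.Nat.Properties as ℕ hiding (_≟_)
import Data.Nat.Solver as ℕ
open import Data.Product.Base using (∃; _×_; _,_; proj₁; proj₂)
open import Data.Rational.Base as ℚ using (ℚ; 0ℚ; 1ℚ)
import Data.Rational.Properties as ℚ
import Data.Rational.Solver as ℚ
import Data.Rational.Unnormalised.Base as ℚᵘ
import Data.Rational.Unnormalised.Properties as ℚᵘ
open import Data.Sum.Base using (inj₁; inj₂)
open import Function.Base using (_∘_)
open import Function.Bundles using (mk⇔)
open import Relation.Binary.PropositionalEquality
open import Relation.Nullary using (does; yes; no; contradiction)
open import Relation.Nullary.Decidable using (does-⇔)

private
  module ∑ℕ = Sum +-*-semiring
  module ∑ℚ = Sum (Ring.semiring ℚ.+-*-ring)

open ∑ℚ using (sum-syntax)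

-- Natural numbers inside the rationals, and finite sums.

ι : ℕ → ℚ
ι m = ℤ.+ m ℚ./ 1

ι-+ : ∀ m n → ι (m + n) ≡ ι m ℚ.+ ι n
ι-+ m n = ℚ.toℚᵘ-injective (begin
  ℚ.toℚᵘ (ι (m + n))                  ≈⟨ ℚ.toℚᵘ-fromℚᵘ (ℚᵘ.mkℚᵘ (ℤ.+ (m + n)) 0) ⟩
  ℚᵘ.mkℚᵘ (ℤ.+ (m + n)) 0             ≈⟨ ℚᵘ.*≡* (cong (ℤ._* ℤ.+ 1) numerators) ⟩
  ℚᵘ.mkℚᵘ (ℤ.+ m) 0 ℚᵘ.+ ℚᵘ.mkℚᵘ (ℤ.+ n) 0
    ≈⟨ ℚᵘ.+-cong (ℚ.toℚᵘ-fromℚᵘ (ℚᵘ.mkℚᵘ (ℤ.+ m) 0)) (ℚ.toℚᵘ-fromℚᵘ (ℚᵘ.mkℚᵘ (ℤ.+ n) 0)) ⟨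
  ℚ.toℚᵘ (ι m) ℚᵘ.+ ℚ.toℚᵘ (ι n)      ≈⟨ ℚ.toℚᵘ-homo-+ (ι m) (ι n) ⟨
  ℚ.toℚᵘ (ι m ℚ.+ ι n)                ∎)
  where
  open ℚᵘ.≃-Reasoning
  numerators : ℤ.+ (m + n) ≡ ℤ.+ m ℤ.* ℤ.+ 1 ℤ.+ ℤ.+ n ℤ.* ℤ.+ 1
  numerators = sym (cong₂ ℤ._+_ (ℤ.*-identityʳ (ℤ.+ m)) (ℤ.*-identityʳ (ℤ.+ n)))

ι-* : ∀ m n → ι (m * n) ≡ ι m ℚ.* ι n
ι-* zero    n = sym (ℚ.*-zeroˡ (ι n))
ι-* (suc m) n = begin
  ι (n + m * n)               ≡⟨ ι-+ n (m * n) ⟩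
  ι n ℚ.+ ι (m * n)           ≡⟨ cong₂ ℚ._+_ (sym (ℚ.*-identityˡ (ι n))) (ι-* m n) ⟩
  1ℚ ℚ.* ι n ℚ.+ ι m ℚ.* ι n  ≡⟨ ℚ.*-distribʳ-+ (ι n) 1ℚ (ι m) ⟨
  (1ℚ ℚ.+ ι m) ℚ.* ι n        ≡⟨ cong (ℚ._* ι n) (ι-+ 1 m) ⟨
  ι (suc m) ℚ.* ι n           ∎
  where open ≡-Reasoning

ι-sum : ∀ {m} (f : Fin m → ℕ) → ι (∑ℕ.sum f) ≡ ∑[ x < m ] ι (f x)
ι-sum {zero}  f = refl
ι-sum {suc m} f = trans (ι-+ (f zero) _) (cong (ι (f zero) ℚ.+_) (ι-sum (f ∘ Fin.suc)))

ι-suc-inverse : ∀ m → ∃ λ w → w ℚ.* ι (suc m) ≡ 1ℚ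
ι-suc-inverse m = ℚ.1/ ι (suc m) , ℚ.*-inverseˡ (ι (suc m))
  where
  instance
    ι≢0 : ℚ.NonZero (ι (suc m))
    ι≢0 = ℚ.pos⇒nonZero (ι (suc m)) {{ℚ.normalize-pos (suc m) 1}}

sum-zero : ∀ {m} (f : Fin m → ℚ) → (∀ x → f x ≡ 0ℚ) → ∑[ x < m ] f x ≡ 0ℚ
sum-zero {m} f f≡0 = trans (∑ℚ.sum-cong-≗ f≡0) (∑ℚ.sum-replicate-zero m)

sum-1ₘ : ∀ {m} (w : Fin m) (g : Fin m → ℚ) → ∑[ v < m ] (1ₘ w v ℚ.* g v) ≡ g w
sum-1ₘ {suc m} zero g = begin
  1ℚ ℚ.* g zero ℚ.+ ∑[ v < m ] (0ℚ ℚ.* g (Fin.suc v))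
    ≡⟨ cong₂ ℚ._+_ (ℚ.*-identityˡ (g zero)) (sum-zero {m} _ (λ v → ℚ.*-zeroˡ (g (Fin.suc v)))) ⟩
  g zero ℚ.+ 0ℚ  ≡⟨ ℚ.+-identityʳ (g zero) ⟩
  g zero         ∎
  where open ≡-Reasoning
sum-1ₘ {suc m} (Fin.suc w) g = begin
  0ℚ ℚ.* g zero ℚ.+ ∑[ v < m ] (1ₘ w v ℚ.* g (Fin.suc v))
    ≡⟨ cong₂ ℚ._+_ (ℚ.*-zeroˡ (g zero)) (sum-1ₘ w (g ∘ Fin.suc)) ⟩
  0ℚ ℚ.+ g (Fin.suc w)  ≡⟨ ℚ.+-identityˡ _ ⟩
  g (Fin.suc w)         ∎
  where open ≡-Reasoning

-- The commutative algebra of shift operators.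

infixl 6 _⊕_
infixl 7 _⊗_

-- Polynomials in the shift operator, kept as syntax so that any two of
-- them are seen to commute by induction.
data Operator : Set where
  shift   : ℕ → Operator
  const   : ℚ → Operator
  _⊕_ _⊗_ : Operator → Operator → Operator

-- The action is on all sequences over `ℕ`, so that shifts need no reduction modulo n. Vectors
-- indexed modulo n enter later as the periodic sequences.
⟦_⟧ : Operator → (ℕ → ℚ) → (ℕ → ℚ)
⟦ shift e ⟧ f u = f (u + e)
⟦ const c ⟧ f u = c ℚ.* f u
⟦ p ⊕ q ⟧   f u = ⟦ p ⟧ f u ℚ.+ ⟦ q ⟧ f u
⟦ p ⊗ q ⟧   f u = ⟦ p ⟧ (⟦ q ⟧ f) u

⟦⟧-cong : ∀ p {f g} → f ≗ g → ⟦ p ⟧ f ≗ ⟦ p ⟧ g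
⟦⟧-cong (shift e) f≗g u = f≗g (u + e)
⟦⟧-cong (const c) f≗g u = cong (c ℚ.*_) (f≗g u)
⟦⟧-cong (p ⊕ q)   f≗g u = cong₂ ℚ._+_ (⟦⟧-cong p f≗g u) (⟦⟧-cong q f≗g u)
⟦⟧-cong (p ⊗ q)   f≗g u = ⟦⟧-cong p (⟦⟧-cong q f≗g) u

⟦⟧-+ : ∀ p f g u → ⟦ p ⟧ (λ m → f m ℚ.+ g m) u ≡ ⟦ p ⟧ f u ℚ.+ ⟦ p ⟧ g u
⟦⟧-+ (shift e) f g u = refl
⟦⟧-+ (const c) f g u = ℚ.*-distribˡ-+ c (f u) (g u)
⟦⟧-+ (p ⊕ q)   f g u = trans (cong₂ ℚ._+_ (⟦⟧-+ p f g u) (⟦⟧-+ q f g u))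
  (solve 4 (λ a b c d → (a :+ b) :+ (c :+ d) := (a :+ c) :+ (b :+ d)) refl
    (⟦ p ⟧ f u) (⟦ p ⟧ g u) (⟦ q ⟧ f u) (⟦ q ⟧ g u))
  where open ℚ.+-*-Solver hiding (⟦_⟧)
⟦⟧-+ (p ⊗ q)   f g u = trans (⟦⟧-cong p (⟦⟧-+ q f g) u) (⟦⟧-+ p (⟦ q ⟧ f) (⟦ q ⟧ g) u)

⟦⟧-* : ∀ p c f u → ⟦ p ⟧ (λ m → c ℚ.* f m) u ≡ c ℚ.* ⟦ p ⟧ f u
⟦⟧-* (shift e) c f u = refl
⟦⟧-* (const d) c f u = solve 3 (λ c d x → d :* (c :* x) := c :* (d :* x)) refl c d (f u)
  where open ℚ.+-*-Solver hiding (⟦_⟧)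
⟦⟧-* (p ⊕ q)   c f u = trans (cong₂ ℚ._+_ (⟦⟧-* p c f u) (⟦⟧-* q c f u))
  (sym (ℚ.*-distribˡ-+ c _ _))
⟦⟧-* (p ⊗ q)   c f u = trans (⟦⟧-cong p (⟦⟧-* q c f) u) (⟦⟧-* p c (⟦ q ⟧ f) u)

⟦⟧-zero : ∀ p {f} → (∀ u → f u ≡ 0ℚ) → ∀ u → ⟦ p ⟧ f u ≡ 0ℚ
⟦⟧-zero p {f} f≡0 u = begin
  ⟦ p ⟧ f u                    ≡⟨ ⟦⟧-cong p (λ m → trans (f≡0 m) (sym (ℚ.*-zeroˡ (f m)))) u ⟩
  ⟦ p ⟧ (λ m → 0ℚ ℚ.* f m) u   ≡⟨ ⟦⟧-* p 0ℚ f u ⟩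
  0ℚ ℚ.* ⟦ p ⟧ f u             ≡⟨ ℚ.*-zeroˡ (⟦ p ⟧ f u) ⟩
  0ℚ                           ∎
  where open ≡-Reasoning

-- Linearity in the form needed to compute an operator from its values on the basis sequences `δ`.
⟦⟧-sum : ∀ p {m} (c : Fin m → ℚ) (f : Fin m → ℕ → ℚ) u →
         ⟦ p ⟧ (λ x → ∑[ w < m ] (c w ℚ.* f w x)) u ≡ ∑[ w < m ] (c w ℚ.* ⟦ p ⟧ (f w) u)
⟦⟧-sum p {zero}  c f u = ⟦⟧-zero p (λ _ → refl) u
⟦⟧-sum p {suc m} c f u = trans (⟦⟧-+ p (λ x → c zero ℚ.* f zero x) _ u)
  (cong₂ ℚ._+_ (⟦⟧-* p (c zero) (f zero) u) (⟦⟧-sum p (c ∘ Fin.suc) (f ∘ Fin.suc) u))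

-- The base case of `⟦⟧-comm`, and the reason why operators preserve periodicity.
⟦⟧-shift : ∀ p e f u → ⟦ p ⟧ f (u + e) ≡ ⟦ p ⟧ (λ m → f (m + e)) u
⟦⟧-shift (shift d) e f u = cong f (begin
  u + e + d    ≡⟨ +-assoc u e d ⟩
  u + (e + d)  ≡⟨ cong (u +_) (+-comm e d) ⟩
  u + (d + e)  ≡⟨ +-assoc u d e ⟨
  u + d + e    ∎)
  where open ≡-Reasoning
⟦⟧-shift (const c) e f u = refl
⟦⟧-shift (p ⊕ q)   e f u = cong₂ ℚ._+_ (⟦⟧-shift p e f u) (⟦⟧-shift q e f u)
⟦⟧-shift (p ⊗ q)   e f u = trans (⟦⟧-shift p e (⟦ q ⟧ f) u) (⟦⟧-cong p (⟦⟧-shift q e f) u)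

-- Induction on `p` alone suffices: `q` is linear and commutes with shifts, which settles the
-- generators and sums.
⟦⟧-comm : ∀ p q f → ⟦ p ⟧ (⟦ q ⟧ f) ≗ ⟦ q ⟧ (⟦ p ⟧ f)
⟦⟧-comm (shift e) q f u = ⟦⟧-shift q e f u
⟦⟧-comm (const c) q f u = sym (⟦⟧-* q c f u)
⟦⟧-comm (p ⊕ p′)  q f u = trans (cong₂ ℚ._+_ (⟦⟧-comm p q f u) (⟦⟧-comm p′ q f u))
  (sym (⟦⟧-+ q (⟦ p ⟧ f) (⟦ p′ ⟧ f) u))
⟦⟧-comm (p ⊗ p′)  q f u = trans (⟦⟧-cong p (⟦⟧-comm p′ q f) u) (⟦⟧-comm p q (⟦ p′ ⟧ f) u)

-- Geometric sums in a power of the shift.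

one : Operator
one = const 1ℚ

-- This is [r](y) for y = xᵃ, in Horner form.
geom : ℕ → ℕ → Operator
geom zero    a = const 0ℚ
geom (suc r) a = one ⊕ (shift a ⊗ geom r a)

geom-suc : ∀ r a f u → ⟦ geom (suc r) a ⟧ f u ≡ f u ℚ.+ ⟦ geom r a ⟧ f (u + a)
geom-suc r a f u = cong (ℚ._+ ⟦ geom r a ⟧ f (u + a)) (ℚ.*-identityˡ (f u))

geom-+ : ∀ r m a f u →
         ⟦ geom (r + m) a ⟧ f u ≡ ⟦ geom r a ⟧ f u ℚ.+ ⟦ geom m a ⟧ f (u + r * a)
geom-+ zero m a f u = begin
  ⟦ geom m a ⟧ f u                        ≡⟨ cong (⟦ geom m a ⟧ f) (+-identityʳ u) ⟨
  ⟦ geom m a ⟧ f (u + 0)                  ≡⟨ ℚ.+-identityˡ _ ⟨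
  0ℚ ℚ.+ ⟦ geom m a ⟧ f (u + 0)           ≡⟨ cong (ℚ._+ ⟦ geom m a ⟧ f (u + 0)) (ℚ.*-zeroˡ (f u)) ⟨
  0ℚ ℚ.* f u ℚ.+ ⟦ geom m a ⟧ f (u + 0)   ∎
  where open ≡-Reasoning
geom-+ (suc r) m a f u = begin
  1ℚ ℚ.* f u ℚ.+ ⟦ geom (r + m) a ⟧ f (u + a)
    ≡⟨ cong (1ℚ ℚ.* f u ℚ.+_) (geom-+ r m a f (u + a)) ⟩
  1ℚ ℚ.* f u ℚ.+ (⟦ geom r a ⟧ f (u + a) ℚ.+ ⟦ geom m a ⟧ f (u + a + r * a))
    ≡⟨ ℚ.+-assoc (1ℚ ℚ.* f u) _ _ ⟨
  ⟦ geom (suc r) a ⟧ f u ℚ.+ ⟦ geom m a ⟧ f (u + a + r * a)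
    ≡⟨ cong (λ x → ⟦ geom (suc r) a ⟧ f u ℚ.+ ⟦ geom m a ⟧ f x) (+-assoc u a (r * a)) ⟩
  ⟦ geom (suc r) a ⟧ f u ℚ.+ ⟦ geom m a ⟧ f (u + suc r * a)  ∎
  where open ≡-Reasoning

-- The sr terms are grouped into s blocks of r, which gives [sr](y) = [s](yʳ)·[r](y).
geom-* : ∀ s r a f u → ⟦ geom (s * r) a ⟧ f u ≡ ⟦ geom s (r * a) ⟧ (⟦ geom r a ⟧ f) u
geom-* zero    r a f u = trans (ℚ.*-zeroˡ (f u)) (sym (ℚ.*-zeroˡ (⟦ geom r a ⟧ f u)))
geom-* (suc s) r a f u = begin
  ⟦ geom (r + s * r) a ⟧ f u
    ≡⟨ geom-+ r (s * r) a f u ⟩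
  ⟦ geom r a ⟧ f u ℚ.+ ⟦ geom (s * r) a ⟧ f (u + r * a)
    ≡⟨ cong (⟦ geom r a ⟧ f u ℚ.+_) (geom-* s r a f (u + r * a)) ⟩
  ⟦ geom r a ⟧ f u ℚ.+ ⟦ geom s (r * a) ⟧ (⟦ geom r a ⟧ f) (u + r * a)
    ≡⟨ geom-suc s (r * a) (⟦ geom r a ⟧ f) u ⟨
  ⟦ geom (suc s) (r * a) ⟧ (⟦ geom r a ⟧ f) u  ∎
  where open ≡-Reasoning

geom-sum : ∀ r a f u → ⟦ geom r a ⟧ f u ≡ ∑[ t < r ] f (u + toℕ t * a)
geom-sum zero    a f u = ℚ.*-zeroˡ (f u)
geom-sum (suc r) a f u = begin
  ⟦ geom (suc r) a ⟧ f u                       ≡⟨ geom-suc r a f u ⟩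
  f u ℚ.+ ⟦ geom r a ⟧ f (u + a)               ≡⟨ cong (f u ℚ.+_) (geom-sum r a f (u + a)) ⟩
  f u ℚ.+ ∑[ t < r ] f (u + a + toℕ t * a)
    ≡⟨ cong₂ ℚ._+_ (cong f (sym (+-identityʳ u)))
                   (∑ℚ.sum-cong-≗ {r} (λ t → cong f (+-assoc u a (toℕ t * a)))) ⟩
  f (u + 0) ℚ.+ ∑[ t < r ] f (u + (a + toℕ t * a))  ∎
  where open ≡-Reasoning

-- All r terms coincide. With E in place of `f` this yields E² = NE.
geom-fixed : ∀ r a f → (∀ u → f (u + a) ≡ f u) → ∀ u → ⟦ geom r a ⟧ f u ≡ ι r ℚ.* f u
geom-fixed zero    a f fixed u = refl
geom-fixed (suc r) a f fixed u = begin
  1ℚ ℚ.* f u ℚ.+ ⟦ geom r a ⟧ f (u + a)  ≡⟨ cong (1ℚ ℚ.* f u ℚ.+_) (geom-fixed r a f fixed (u + a)) ⟩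
  1ℚ ℚ.* f u ℚ.+ ι r ℚ.* f (u + a)       ≡⟨ cong (λ x → 1ℚ ℚ.* f u ℚ.+ ι r ℚ.* x) (fixed u) ⟩
  1ℚ ℚ.* f u ℚ.+ ι r ℚ.* f u             ≡⟨ ℚ.*-distribʳ-+ (f u) 1ℚ (ι r) ⟨
  (1ℚ ℚ.+ ι r) ℚ.* f u                   ≡⟨ cong (ℚ._* f u) (ι-+ 1 r) ⟨
  ι (suc r) ℚ.* f u                      ∎
  where open ≡-Reasoning

-- The telescoping identity [r](y)·(1 - y) = 1 - yʳ.
geom-difference : ∀ r a (f : ℕ → ℚ) u →
  ⟦ geom r a ⟧ (λ m → f m ℚ.- f (m + a)) u ≡ f u ℚ.- f (u + r * a)
geom-difference zero a f u = begin
  0ℚ ℚ.* (f u ℚ.- f (u + a))  ≡⟨ ℚ.*-zeroˡ (f u ℚ.- f (u + a)) ⟩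
  0ℚ                          ≡⟨ ℚ.+-inverseʳ (f u) ⟨
  f u ℚ.- f u                 ≡⟨ cong (λ x → f u ℚ.- f x) (+-identityʳ u) ⟨
  f u ℚ.- f (u + 0)           ∎
  where open ≡-Reasoning
geom-difference (suc r) a f u = begin
  ⟦ geom (suc r) a ⟧ (λ m → f m ℚ.- f (m + a)) u
    ≡⟨ geom-suc r a (λ m → f m ℚ.- f (m + a)) u ⟩
  (f u ℚ.- f (u + a)) ℚ.+ ⟦ geom r a ⟧ (λ m → f m ℚ.- f (m + a)) (u + a)
    ≡⟨ cong ((f u ℚ.- f (u + a)) ℚ.+_) (geom-difference r a f (u + a)) ⟩
  (f u ℚ.- f (u + a)) ℚ.+ (f (u + a) ℚ.- f (u + a + r * a))
    ≡⟨ solve 3 (λ x y z → (x :- y) :+ (y :- z) := x :- z) refl (f u) (f (u + a)) (f (u + a + r * a)) ⟩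
  f u ℚ.- f (u + a + r * a)
    ≡⟨ cong (λ x → f u ℚ.- f x) (+-assoc u a (r * a)) ⟩
  f u ℚ.- f (u + suc r * a)  ∎
  where
  open ≡-Reasoning
  open ℚ.+-*-Solver hiding (⟦_⟧)

-- Periodic sequences, on which xⁿ = 1.

Periodic : ℕ → (ℕ → ℚ) → Set
Periodic n f = ∀ u → f (u + n) ≡ f u

periodic-∣ : ∀ {n m f} → Periodic n f → n ∣ m → Periodic m f
periodic-∣ {n} {f = f} per (divides q refl) = multiple q
  where
  multiple : ∀ q u → f (u + q * n) ≡ f u
  multiple zero    u = cong f (+-identityʳ u)
  multiple (suc q) u = trans (cong f (sym (+-assoc u n (q * n)))) (trans (multiple q (u + n)) (per u))

periodic-⟦⟧ : ∀ p {n f} → Periodic n f → Periodic n (⟦ p ⟧ f)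
periodic-⟦⟧ p {n} {f} per u = trans (⟦⟧-shift p n f u) (⟦⟧-cong p per u)

-- This is yE = E when y^N = 1. Splitting off the first or the last term of [N+1](y) gives 1 + yE =
-- E + y^N = E + 1, and the 1 cancels.
geom-full-cycle : ∀ N a f → Periodic (N * a) f → Periodic a (⟦ geom N a ⟧ f)
geom-full-cycle N a f per u = ∙-cancelˡ (f u) _ _ (begin
  f u ℚ.+ ⟦ geom N a ⟧ f (u + a)          ≡⟨ geom-suc N a f u ⟨
  ⟦ geom (1 + N) a ⟧ f u                  ≡⟨ cong (λ r → ⟦ geom r a ⟧ f u) (+-comm 1 N) ⟩
  ⟦ geom (N + 1) a ⟧ f u                  ≡⟨ geom-+ N 1 a f u ⟩
  ⟦ geom N a ⟧ f u ℚ.+ ⟦ geom 1 a ⟧ f (u + N * a)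
    ≡⟨ cong (⟦ geom N a ⟧ f u ℚ.+_) last ⟩
  ⟦ geom N a ⟧ f u ℚ.+ f u                ≡⟨ ℚ.+-comm _ (f u) ⟩
  f u ℚ.+ ⟦ geom N a ⟧ f u                ∎)
  where
  open Group (Ring.+-group ℚ.+-*-ring) using (∙-cancelˡ)
  open ≡-Reasoning
  last : ⟦ geom 1 a ⟧ f (u + N * a) ≡ f u
  last = begin
    ⟦ geom 1 a ⟧ f (u + N * a)                 ≡⟨ geom-suc 0 a f (u + N * a) ⟩
    f (u + N * a) ℚ.+ 0ℚ ℚ.* f (u + N * a + a)  ≡⟨ cong (f (u + N * a) ℚ.+_) (ℚ.*-zeroˡ (f (u + N * a + a))) ⟩
    f (u + N * a) ℚ.+ 0ℚ                       ≡⟨ ℚ.+-identityʳ _ ⟩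
    f (u + N * a)                              ≡⟨ per u ⟩
    f u                                        ∎

-- After the leading 1, the remaining qN terms form q blocks. Each block equals yE since y^N = 1,
-- and yE = E.
geom-wrap : ∀ q N a f → Periodic (N * a) f → ∀ u →
            ⟦ geom (suc (q * N)) a ⟧ f u ≡ f u ℚ.+ ι q ℚ.* ⟦ geom N a ⟧ f u
geom-wrap q N a f per u = begin
  ⟦ geom (suc (q * N)) a ⟧ f u             ≡⟨ geom-suc (q * N) a f u ⟩
  f u ℚ.+ ⟦ geom (q * N) a ⟧ f (u + a)     ≡⟨ cong (f u ℚ.+_) (geom-* q N a f (u + a)) ⟩
  f u ℚ.+ ⟦ geom q (N * a) ⟧ Ef (u + a)
    ≡⟨ cong (f u ℚ.+_) (geom-fixed q (N * a) Ef (periodic-⟦⟧ (geom N a) per) (u + a)) ⟩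
  f u ℚ.+ ι q ℚ.* Ef (u + a)               ≡⟨ cong (λ x → f u ℚ.+ ι q ℚ.* x) (geom-full-cycle N a f per u) ⟩
  f u ℚ.+ ι q ℚ.* Ef u                     ∎
  where
  open ≡-Reasoning
  Ef = ⟦ geom N a ⟧ f

-- Invertible geometric sums.

HasInverse : ℕ → Operator → Set
HasInverse n p = ∃ λ q → ∀ f → Periodic n f → ⟦ p ⟧ (⟦ q ⟧ f) ≗ f

⊗-hasInverse : ∀ {n} p p′ → HasInverse n p → HasInverse n p′ → HasInverse n (p ⊗ p′)
⊗-hasInverse p p′ (q , pq≗1) (q′ , p′q′≗1) = q′ ⊗ q , λ f per u →
  trans (⟦⟧-cong p (p′q′≗1 (⟦ q ⟧ f) (periodic-⟦⟧ q per)) u) (pq≗1 f per u)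

-- Since xⁿ = 1, the inverse of xⁱ is xⁿ⁻ⁱ.
shift-hasInverse : ∀ {n i} → i ≤ n → HasInverse n (shift i)
shift-hasInverse {n} {i} i≤n = shift (n ∸ i) , λ f per u →
  trans (cong f (trans (+-assoc u i _) (cong (u +_) (m+[n∸m]≡n i≤n)))) (per u)

-- The divisibility says y^N = 1. Then [s](yʳ)·[r](y) = 1 + qE, and `X` inverts the right-hand side.
geom-hasInverse′ : ∀ {n} r a N s q → n ∣ N * a → s * r ≡ suc (q * N) →
                   HasInverse n (geom r a)
geom-hasInverse′ {n} r a N s q n∣Na sr≡1+qN =
  geom s (r * a) ⊗ X , λ f per u → inverse f (periodic-∣ per n∣Na) u
  where
  open ≡-Reasoning
  open ℚ.+-*-Solver hiding (⟦_⟧)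
  -- `w` is (1 + qN)⁻¹, and `c` is the coefficient for which (1 + qE)(1 + cE) = 1 once E² = NE.
  w c : ℚ
  w = proj₁ (ι-suc-inverse (q * N))
  c = ℚ.- (ι q ℚ.* w)
  X : Operator
  X = one ⊕ (const c ⊗ geom N a)

  w-inverse : w ℚ.* (1ℚ ℚ.+ ι q ℚ.* ι N) ≡ 1ℚ
  w-inverse = begin
    w ℚ.* (1ℚ ℚ.+ ι q ℚ.* ι N)  ≡⟨ cong (λ x → w ℚ.* (1ℚ ℚ.+ x)) (ι-* q N) ⟨
    w ℚ.* (1ℚ ℚ.+ ι (q * N))    ≡⟨ cong (w ℚ.*_) (ι-+ 1 (q * N)) ⟨
    w ℚ.* ι (suc (q * N))       ≡⟨ proj₂ (ι-suc-inverse (q * N)) ⟩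
    1ℚ                          ∎

  -- The left side is (1 + qE)·`X` applied to a sequence with value `x`, where `e` is the value of E
  -- on it. The coefficient of `e` is q - q·w(1 + qN) = 0.
  cancel : ∀ x e → (1ℚ ℚ.* x ℚ.+ c ℚ.* e) ℚ.+ ι q ℚ.* (1ℚ ℚ.* e ℚ.+ c ℚ.* (ι N ℚ.* e)) ≡ x
  cancel x e = begin
    (1ℚ ℚ.* x ℚ.+ c ℚ.* e) ℚ.+ ι q ℚ.* (1ℚ ℚ.* e ℚ.+ c ℚ.* (ι N ℚ.* e))
      ≡⟨ solve 5 (λ x e q N w →
           (con 1ℚ :* x :+ (:- (q :* w)) :* e) :+ q :* (con 1ℚ :* e :+ (:- (q :* w)) :* (N :* e))
             := x :+ (q :* e :- (q :* e) :* (w :* (con 1ℚ :+ q :* N)))) refl x e (ι q) (ι N) w ⟩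
    x ℚ.+ (ι q ℚ.* e ℚ.- (ι q ℚ.* e) ℚ.* (w ℚ.* (1ℚ ℚ.+ ι q ℚ.* ι N)))
      ≡⟨ cong (λ y → x ℚ.+ (ι q ℚ.* e ℚ.- (ι q ℚ.* e) ℚ.* y)) w-inverse ⟩
    x ℚ.+ (ι q ℚ.* e ℚ.- (ι q ℚ.* e) ℚ.* 1ℚ)
      ≡⟨ solve 2 (λ x y → x :+ (y :- y :* con 1ℚ) := x) refl x (ι q ℚ.* e) ⟩
    x  ∎

  module _ (f : ℕ → ℚ) (per : Periodic (N * a) f) where
    Ef : ℕ → ℚ
    Ef = ⟦ geom N a ⟧ f

    E-X : ∀ u → ⟦ geom N a ⟧ (⟦ X ⟧ f) u ≡ 1ℚ ℚ.* Ef u ℚ.+ c ℚ.* (ι N ℚ.* Ef u)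
    -- E is moved past `X` so that it meets the E inside `X`, where E² = NE applies.
    E-X u = trans (⟦⟧-comm (geom N a) X f u)
      (cong (λ x → 1ℚ ℚ.* Ef u ℚ.+ c ℚ.* x) (geom-fixed N a Ef (geom-full-cycle N a f per) u))

    inverse : ⟦ geom r a ⟧ (⟦ geom s (r * a) ⟧ (⟦ X ⟧ f)) ≗ f
    inverse u = begin
      ⟦ geom r a ⟧ (⟦ geom s (r * a) ⟧ (⟦ X ⟧ f)) u
        ≡⟨ ⟦⟧-comm (geom r a) (geom s (r * a)) (⟦ X ⟧ f) u ⟩
      ⟦ geom s (r * a) ⟧ (⟦ geom r a ⟧ (⟦ X ⟧ f)) u
        ≡⟨ geom-* s r a (⟦ X ⟧ f) u ⟨
      ⟦ geom (s * r) a ⟧ (⟦ X ⟧ f) u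
        ≡⟨ cong (λ m → ⟦ geom m a ⟧ (⟦ X ⟧ f) u) sr≡1+qN ⟩
      ⟦ geom (suc (q * N)) a ⟧ (⟦ X ⟧ f) u
        ≡⟨ geom-wrap q N a (⟦ X ⟧ f) (periodic-⟦⟧ X per) u ⟩
      ⟦ X ⟧ f u ℚ.+ ι q ℚ.* ⟦ geom N a ⟧ (⟦ X ⟧ f) u
        ≡⟨ cong (λ x → ⟦ X ⟧ f u ℚ.+ ι q ℚ.* x) (E-X u) ⟩
      ⟦ X ⟧ f u ℚ.+ ι q ℚ.* (1ℚ ℚ.* Ef u ℚ.+ c ℚ.* (ι N ℚ.* Ef u))
        ≡⟨ cancel (f u) (Ef u) ⟩
      f u  ∎

-- Both `s` and `q` must be natural, as they count terms of geometric sums. Bézout over the naturals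
-- yields xr = 1 + yN or 1 + xr = yN, and the second form has to be converted.
inverse-modulo : ∀ r N .{{_ : NonZero r}} → Coprime r N → ∃ λ s → ∃ λ q → s * r ≡ suc (q * N)
inverse-modulo r@(suc r′) N coprime with coprime-Bézout coprime
... | Bézout.+- x y 1+yN≡xr = x , y , sym 1+yN≡xr
... | Bézout.-+ x y 1+xr≡yN with x * r in xr≡w
-- Here yN = 1, so N = 1, and r = 1 + (r - 1)·1 serves.
...   | zero rewrite m*n≡1⇒n≡1 y N (sym 1+xr≡yN) =
  1 , r′ , cong suc (trans (+-identityʳ r′) (sym (*-identityʳ r′)))
-- Here xr ≡ -1 mod N, so that x(xr) is an inverse of r.
...   | suc w = x * suc w , w * y , (begin
  x * suc w * r          ≡⟨ solve 3 (λ x v r → x :* v :* r := v :* (x :* r)) refl x (suc w) r ⟩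
  suc w * (x * r)        ≡⟨ cong (suc w *_) xr≡w ⟩
  suc w * suc w
    ≡⟨ solve 1 (λ w → (con 1 :+ w) :* (con 1 :+ w) := con 1 :+ w :* (con 2 :+ w)) refl w ⟩
  suc (w * suc (suc w))  ≡⟨ cong (λ m → suc (w * m)) 1+xr≡yN ⟩
  suc (w * (y * N))      ≡⟨ cong suc (*-assoc w y N) ⟨
  suc (w * y * N)        ∎)
  where
  open ≡-Reasoning
  open ℕ.+-*-Solver

geom-hasInverse : ∀ {n} r a N .{{_ : NonZero r}} → n ∣ N * a → Coprime r N →
                  HasInverse n (geom r a)
geom-hasInverse r a N n∣Na coprime with inverse-modulo r N coprime
... | s , q , sr≡1+qN = geom-hasInverse′ r a N s q n∣Na sr≡1+qN

-- Geometric sums with a nonzero kernel.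

HasKernel : ℕ → Operator → Set
HasKernel n p = ∃ λ f → Periodic n f × (∀ u → ⟦ p ⟧ f u ≡ 0ℚ) × f 0 ≢ 0ℚ

⊗-hasKernelʳ : ∀ {n} p q → HasKernel n q → HasKernel n (p ⊗ q)
⊗-hasKernelʳ p q (f , per , qf≡0 , f0≢0) = f , per , ⟦⟧-zero p qf≡0 , f0≢0

⊗-hasKernelˡ : ∀ {n} p q → HasKernel n p → HasKernel n (p ⊗ q)
⊗-hasKernelˡ p q (f , per , pf≡0 , f0≢0) =
  f , per , (λ u → trans (⟦⟧-comm p q f u) (⟦⟧-zero q pf≡0 u)) , f0≢0

-- The kernel element is (1 - y) applied to the indicator of the multiples of D. By telescoping,
-- [r](y) turns it into (1 - yʳ) applied to that indicator, which vanishes as D divides ra.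
geom-hasKernel : ∀ {n} r a D → D ∣ n → D ∣ r * a → D ∤ a → HasKernel n (geom r a)
geom-hasKernel {n} r a D D∣n D∣ra D∤a = v , periodic , killed , v0≢0
  where
  multiple : ℕ → ℚ
  multiple m = if does (D ∣? m) then 1ℚ else 0ℚ

  multiple-periodic : ∀ {c} → D ∣ c → Periodic c multiple
  multiple-periodic {c} D∣c u = cong (if_then 1ℚ else 0ℚ)
    (does-⇔ (mk⇔ (λ D∣u+c → ∣m+n∣m⇒∣n (subst (D ∣_) (+-comm u c) D∣u+c) D∣c)
                 (λ D∣u → ∣m∣n⇒∣m+n D∣u D∣c))
            (D ∣? (u + c)) (D ∣? u))

  v : ℕ → ℚ
  v m = multiple m ℚ.- multiple (m + a)

  periodic : Periodic n v
  periodic u = cong₂ ℚ._-_ (multiple-periodic D∣n u)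
    (trans (⟦⟧-shift (shift a) n multiple u) (multiple-periodic D∣n (u + a)))

  killed : ∀ u → ⟦ geom r a ⟧ v u ≡ 0ℚ
  killed u = begin
    ⟦ geom r a ⟧ v u                        ≡⟨ geom-difference r a multiple u ⟩
    multiple u ℚ.- multiple (u + r * a)     ≡⟨ cong (λ x → multiple u ℚ.- x) (multiple-periodic D∣ra u) ⟩
    multiple u ℚ.- multiple u               ≡⟨ ℚ.+-inverseʳ (multiple u) ⟩
    0ℚ                                      ∎
    where open ≡-Reasoning

  v0≢0 : v 0 ≢ 0ℚ
  -- The value at 0 is 1 - 0, since D divides 0 but not a.
  v0≢0 with D ∣? 0 | D ∣? a
  ... | yes _  | no _    = λ ()
  ... | yes _  | yes D∣a = contradiction D∣a D∤a
  ... | no D∤0 | _       = contradiction (D ∣0) D∤0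

-- Matrices as operators on periodic sequences.

module _ {n : ℕ} .{{_ : NonZero n}} where

  -- The periodic extension of the standard basis vector at `v`.
  δ : Fin n → ℕ → ℚ
  δ v m = 1ₘ (m mod n) v

  toℕ-mod : (u : Fin n) → toℕ u mod n ≡ u
  toℕ-mod u = Fin.toℕ-injective (trans (Fin.toℕ-fromℕ< _) (m<n⇒m%n≡m (Fin.toℕ<n u)))

  mod-periodic : ∀ m → (m + n) mod n ≡ m mod n
  mod-periodic m = Fin.fromℕ<-cong _ _ ([m+n]%n≡m%n m n) _ _

  δ-periodic : ∀ v → Periodic n (δ v)
  δ-periodic v m = cong (λ x → 1ₘ x v) (mod-periodic m)

  periodic-mod : ∀ {f} → Periodic n f → ∀ m → f (toℕ (m mod n)) ≡ f m
  periodic-mod {f} per m = begin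
    f (toℕ (m mod n))           ≡⟨ cong f (Fin.toℕ-fromℕ< _) ⟩
    f (m % n)                   ≡⟨ periodic-∣ per (divides-refl (m / n)) (m % n) ⟨
    f (m % n + m / n * n)       ≡⟨ cong f (m≡m%n+[m/n]*n m n) ⟨
    f m                         ∎
    where open ≡-Reasoning

  δ-expansion : ∀ {f} → Periodic n f → ∀ m → f m ≡ ∑[ w < n ] (f (toℕ w) ℚ.* δ w m)
  δ-expansion {f} per m = begin
    f m                                   ≡⟨ periodic-mod per m ⟨
    f (toℕ (m mod n))                     ≡⟨ sum-1ₘ (m mod n) (f ∘ toℕ) ⟨
    ∑[ w < n ] (δ w m ℚ.* f (toℕ w))      ≡⟨ ∑ℚ.sum-cong-≗ (λ w → ℚ.*-comm (δ w m) (f (toℕ w))) ⟩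
    ∑[ w < n ] (f (toℕ w) ℚ.* δ w m)      ∎
    where open ≡-Reasoning

  δ-toℕ : ∀ u v → δ v (toℕ u) ≡ 1ₘ u v
  δ-toℕ u v = cong (λ x → 1ₘ x v) (toℕ-mod u)

  Represents : Matrix ℚ n → Operator → Set
  Represents A p = ∀ {f} → Periodic n f → ∀ u → ∑[ w < n ] (A u w ℚ.* f (toℕ w)) ≡ ⟦ p ⟧ f (toℕ u)

  toMatrix : Operator → Matrix ℚ n
  toMatrix p u v = ⟦ p ⟧ (δ v) (toℕ u)

  toMatrix-represents : ∀ p → Represents (toMatrix p) p
  toMatrix-represents p {f} per u = begin
    ∑[ w < n ] (⟦ p ⟧ (δ w) (toℕ u) ℚ.* f (toℕ w))
      ≡⟨ ∑ℚ.sum-cong-≗ (λ w → ℚ.*-comm (⟦ p ⟧ (δ w) (toℕ u)) (f (toℕ w))) ⟩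
    ∑[ w < n ] (f (toℕ w) ℚ.* ⟦ p ⟧ (δ w) (toℕ u))
      ≡⟨ ⟦⟧-sum p (f ∘ toℕ) δ (toℕ u) ⟨
    ⟦ p ⟧ (λ m → ∑[ w < n ] (f (toℕ w) ℚ.* δ w m)) (toℕ u)
      ≡⟨ ⟦⟧-cong p (δ-expansion per) (toℕ u) ⟨
    ⟦ p ⟧ f (toℕ u)  ∎
    where open ≡-Reasoning

  -- Applying `A` to the basis sequence `δ v` picks out column `v`.
  represents-column : ∀ A p → Represents A p → ∀ u v → A u v ≡ ⟦ p ⟧ (δ v) (toℕ u)
  represents-column A p A-p u v = begin
    A u v                                  ≡⟨ sum-1ₘ v (A u) ⟨
    ∑[ w < n ] (1ₘ v w ℚ.* A u w)          ≡⟨ ∑ℚ.sum-cong-≗ (λ w → trans (ℚ.*-comm _ (A u w))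
                                               (cong (A u w ℚ.*_) (1ₘ-δ w))) ⟩
    ∑[ w < n ] (A u w ℚ.* δ v (toℕ w))     ≡⟨ A-p (δ-periodic v) u ⟩
    ⟦ p ⟧ (δ v) (toℕ u)                    ∎
    where
    open ≡-Reasoning
    1ₘ-δ : ∀ w → 1ₘ v w ≡ δ v (toℕ w)
    1ₘ-δ w = trans (cong (if_then 1ℚ else 0ℚ) (does-⇔ (mk⇔ sym sym) (v Fin.≟ w) (w Fin.≟ v)))
                   (sym (δ-toℕ w v))

  -- A one-sided operator inverse gives a two-sided matrix inverse because operators commute.
  hasInverse⇒invertible : ∀ A p → Represents A p → HasInverse n p → Invertible A
  hasInverse⇒invertible A p A-p (q , pq≗1) = toMatrix q , right , left
    where
    open ≡-Reasoning
    right : A *ₘ toMatrix q ≈ₘ 1ₘ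
    right u v = begin
      ∑[ w < n ] (A u w ℚ.* ⟦ q ⟧ (δ v) (toℕ w))  ≡⟨ A-p (periodic-⟦⟧ q (δ-periodic v)) u ⟩
      ⟦ p ⟧ (⟦ q ⟧ (δ v)) (toℕ u)                 ≡⟨ pq≗1 (δ v) (δ-periodic v) (toℕ u) ⟩
      δ v (toℕ u)                                 ≡⟨ δ-toℕ u v ⟩
      1ₘ u v                                      ∎

    left : toMatrix q *ₘ A ≈ₘ 1ₘ
    -- Column `v` of `A` is first read as the periodic sequence `⟦ p ⟧ (δ v)`, to which
    -- `toMatrix-represents` applies.
    left u v = begin
      ∑[ w < n ] (toMatrix q u w ℚ.* A w v)
        ≡⟨ ∑ℚ.sum-cong-≗ (λ w → cong (toMatrix q u w ℚ.*_) (represents-column A p A-p w v)) ⟩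
      ∑[ w < n ] (toMatrix q u w ℚ.* ⟦ p ⟧ (δ v) (toℕ w))
        ≡⟨ toMatrix-represents q (periodic-⟦⟧ p (δ-periodic v)) u ⟩
      ⟦ q ⟧ (⟦ p ⟧ (δ v)) (toℕ u)                 ≡⟨ ⟦⟧-comm q p (δ v) (toℕ u) ⟩
      ⟦ p ⟧ (⟦ q ⟧ (δ v)) (toℕ u)                 ≡⟨ pq≗1 (δ v) (δ-periodic v) (toℕ u) ⟩
      δ v (toℕ u)                                 ≡⟨ δ-toℕ u v ⟩
      1ₘ u v                                      ∎

  -- A left inverse B would give f = (BA)f = B(Af) = 0. This is read at entry 0, where `HasKernel`
  -- asks for a nonzero value.
  hasKernel⇒singular : ∀ A p → Represents A p → HasKernel n p → SingularMatrix A
  hasKernel⇒singular A p A-p (f , per , pf≡0 , f0≢0) (B , _ , BA≈1) = f0≢0 (begin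
    f 0                  ≡⟨ periodic-mod per 0 ⟨
    f (toℕ u)            ≡⟨ sum-1ₘ u (f ∘ toℕ) ⟨
    ∑[ w < n ] (1ₘ u w ℚ.* f (toℕ w))
      ≡⟨ ∑ℚ.sum-cong-≗ (λ w → cong (ℚ._* f (toℕ w)) (BA≈1 u w)) ⟨
    ∑[ w < n ] (∑[ x < n ] (B u x ℚ.* A x w) ℚ.* f (toℕ w))
      ≡⟨ ∑ℚ.sum-cong-≗ (λ w → ∑ℚ.*-distribʳ-sum (f (toℕ w)) (λ x → B u x ℚ.* A x w)) ⟩
    ∑[ w < n ] ∑[ x < n ] (B u x ℚ.* A x w ℚ.* f (toℕ w))
      ≡⟨ ∑ℚ.∑-comm (λ w x → B u x ℚ.* A x w ℚ.* f (toℕ w)) ⟩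
    ∑[ x < n ] ∑[ w < n ] (B u x ℚ.* A x w ℚ.* f (toℕ w))
      ≡⟨ sum-zero {n} _ row ⟩
    0ℚ                   ∎)
    where
    open ≡-Reasoning
    u : Fin n
    u = 0 mod n

    row : ∀ x → ∑[ w < n ] (B u x ℚ.* A x w ℚ.* f (toℕ w)) ≡ 0ℚ
    row x = begin
      ∑[ w < n ] (B u x ℚ.* A x w ℚ.* f (toℕ w))
        ≡⟨ ∑ℚ.sum-cong-≗ (λ w → ℚ.*-assoc (B u x) (A x w) (f (toℕ w))) ⟩
      ∑[ w < n ] (B u x ℚ.* (A x w ℚ.* f (toℕ w)))
        ≡⟨ ∑ℚ.*-distribˡ-sum (B u x) (λ w → A x w ℚ.* f (toℕ w)) ⟨
      B u x ℚ.* ∑[ w < n ] (A x w ℚ.* f (toℕ w))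
        ≡⟨ cong (B u x ℚ.*_) (trans (A-p per x) (pf≡0 (toℕ x))) ⟩
      B u x ℚ.* 0ℚ  ≡⟨ ℚ.*-zeroʳ (B u x) ⟩
      0ℚ            ∎

  -- The adjacency matrix as a product of a shift and two geometric sums.

  [m%n+o]%n≡[m+o]%n : ∀ m o → (m % n + o) % n ≡ (m + o) % n
  [m%n+o]%n≡[m+o]%n m o = begin
    (m % n + o) % n          ≡⟨ %-distribˡ-+ (m % n) o n ⟩
    (m % n % n + o % n) % n  ≡⟨ cong (λ x → (x + o % n) % n) (m%n%n≡m%n m n) ⟩
    (m % n + o % n) % n      ≡⟨ %-distribˡ-+ m o n ⟨
    (m + o) % n              ∎
    where open ≡-Reasoning

  around : ∀ (u : Fin n) m → (toℕ u + m + (n ∸ toℕ u)) % n ≡ m % n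
  around u m = begin
    (toℕ u + m + (n ∸ toℕ u)) % n    ≡⟨ cong (λ x → (x + (n ∸ toℕ u)) % n) (+-comm (toℕ u) m) ⟩
    (m + toℕ u + (n ∸ toℕ u)) % n    ≡⟨ cong (_% n) (+-assoc m (toℕ u) _) ⟩
    (m + (toℕ u + (n ∸ toℕ u))) % n  ≡⟨ cong (λ x → (m + x) % n) (m+[n∸m]≡n (<⇒≤ (Fin.toℕ<n u))) ⟩
    (m + n) % n                      ≡⟨ [m+n]%n≡m%n m n ⟩
    m % n                            ∎
    where open ≡-Reasoning

  -- This identifies the one column in which xᵉ has a 1 in row `u`. The bound makes `e` its own
  -- residue, as `offset` is reduced modulo n.
  offset-⇔ : ∀ (u v : Fin n) {e} → e < n → (e ≡ offset u v) ⇔ ((toℕ u + e) mod n ≡ v)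
  offset-⇔ u v {e} e<n = mk⇔ to from
    where
    open ≡-Reasoning
    to : e ≡ offset u v → (toℕ u + e) mod n ≡ v
    to refl = Fin.toℕ-injective (begin
      toℕ ((toℕ u + offset u v) mod n)               ≡⟨ Fin.toℕ-fromℕ< _ ⟩
      (toℕ u + (toℕ v + (n ∸ toℕ u)) % n) % n        ≡⟨ cong (_% n) (+-comm (toℕ u) _) ⟩
      ((toℕ v + (n ∸ toℕ u)) % n + toℕ u) % n        ≡⟨ [m%n+o]%n≡[m+o]%n (toℕ v + (n ∸ toℕ u)) (toℕ u) ⟩
      (toℕ v + (n ∸ toℕ u) + toℕ u) % n              ≡⟨ cong (_% n) (+-comm _ (toℕ u)) ⟩
      (toℕ u + (toℕ v + (n ∸ toℕ u))) % n            ≡⟨ cong (_% n) (+-assoc (toℕ u) (toℕ v) _) ⟨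
      (toℕ u + toℕ v + (n ∸ toℕ u)) % n              ≡⟨ around u (toℕ v) ⟩
      toℕ v % n                                      ≡⟨ m<n⇒m%n≡m (Fin.toℕ<n v) ⟩
      toℕ v                                          ∎)

    from : (toℕ u + e) mod n ≡ v → e ≡ offset u v
    from refl = sym (begin
      (toℕ ((toℕ u + e) mod n) + (n ∸ toℕ u)) % n  ≡⟨ cong (λ x → (x + (n ∸ toℕ u)) % n) (Fin.toℕ-fromℕ< _) ⟩
      ((toℕ u + e) % n + (n ∸ toℕ u)) % n          ≡⟨ [m%n+o]%n≡[m+o]%n (toℕ u + e) _ ⟩
      (toℕ u + e + (n ∸ toℕ u)) % n                ≡⟨ around u e ⟩
      e % n                                        ≡⟨ m<n⇒m%n≡m e<n ⟩
      e                                            ∎)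

  monomial-1ₘ : ∀ (u v : Fin n) {e} → e < n → ι ((x^ e) (offset u v)) ≡ 1ₘ ((toℕ u + e) mod n) v
  monomial-1ₘ u v {e} e<n = trans (ι-indicator (e ≡ᵇ offset u v)) (cong (if_then 1ℚ else 0ℚ)
    (does-⇔ (offset-⇔ u v e<n) (e ℕ.≟ offset u v) ((toℕ u + e) mod n Fin.≟ v)))
    where
    ι-indicator : ∀ b → ι (if b then 1 else 0) ≡ (if b then 1ℚ else 0ℚ)
    ι-indicator true  = refl
    ι-indicator false = refl

  monomial-represents : ∀ {e} → e < n → Represents (λ u v → ι ((x^ e) (offset u v))) (shift e)
  monomial-represents {e} e<n {f} per u = begin
    ∑[ v < n ] (ι ((x^ e) (offset u v)) ℚ.* f (toℕ v))
      ≡⟨ ∑ℚ.sum-cong-≗ (λ v → cong (ℚ._* f (toℕ v)) (monomial-1ₘ u v e<n)) ⟩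
    ∑[ v < n ] (1ₘ ((toℕ u + e) mod n) v ℚ.* f (toℕ v))
      ≡⟨ sum-1ₘ ((toℕ u + e) mod n) (f ∘ toℕ) ⟩
    f (toℕ ((toℕ u + e) mod n))
      ≡⟨ periodic-mod per (toℕ u + e) ⟩
    f (toℕ u + e)  ∎
    where open ≡-Reasoning

  module _ (i j k ℓ : ℕ) (ℓ<j : ℓ < j) (deg : k * j + i + ℓ < n) where

    -- The exponents i + s + tj separate, so the double sum splits into xⁱ, a sum over t with step j
    -- and a sum over s with step 1.
    factored : Operator
    factored = shift i ⊗ (geom (suc k) j ⊗ geom (suc ℓ) 1)

    -- An arc records only whether the coefficient is 1, so the coefficient must be at most 1. It
    -- is, because by `C-representer` it is an adjacency entry or 0.
    adjacency≡C-poly : ∀ u v → adjacency (C n i j k ℓ) u v ≡ C-poly i j k ℓ (offset u v)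
    adjacency≡C-poly u v = indicator (subst (_≤ 1) (C-representer n i j k ℓ ℓ<j deg (offset u v))
                                            (representer≤1 (offset u v)))
      where
      adjacency≤1 : ∀ u v → adjacency (C n i j k ℓ) u v ≤ 1
      adjacency≤1 u v with C n i j k ℓ u v
      ... | true  = ≤-refl
      ... | false = z≤n

      representer≤1 : ∀ m → representer (adjacency (C n i j k ℓ)) m ≤ 1
      representer≤1 m with m ℕ.<? n
      ... | yes m<n = adjacency≤1 (0 mod n) (fromℕ< m<n)
      ... | no  _   = z≤n

      indicator : ∀ {a} → a ≤ 1 → (if a ≡ᵇ 1 then 1 else 0) ≡ a
      indicator z≤n       = refl
      indicator (s≤s z≤n) = refl

    exponent<n : ∀ (t : Fin (suc k)) (s : Fin (suc ℓ)) → i + toℕ s + toℕ t * j < n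
    exponent<n t s = ≤-<-trans (begin
      i + toℕ s + toℕ t * j  ≤⟨ +-mono-≤ (+-monoʳ-≤ i (s≤s⁻¹ (Fin.toℕ<n s)))
                                         (*-monoˡ-≤ j (s≤s⁻¹ (Fin.toℕ<n t))) ⟩
      i + ℓ + k * j          ≡⟨ +-comm (i + ℓ) (k * j) ⟩
      k * j + (i + ℓ)        ≡⟨ +-assoc (k * j) i ℓ ⟨
      k * j + i + ℓ          ∎) deg
      where open ≤-Reasoning

    -- The entries are expanded into monomials and the sum over columns is moved innermost. There
    -- each monomial acts as a shift, and the sums over s and t reassemble into `geom`.
    adjacency-represents : Represents (λ u v → ι (adjacency (C n i j k ℓ) u v)) factored
    adjacency-represents {f} per u = begin
      ∑[ v < n ] (ι (adjacency (C n i j k ℓ) u v) ℚ.* f (toℕ v))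
        ≡⟨ ∑ℚ.sum-cong-≗ entry ⟩
      ∑[ v < n ] ∑[ t < suc k ] ∑[ s < suc ℓ ] term t s v
        ≡⟨ ∑ℚ.∑-comm (λ v t → ∑[ s < suc ℓ ] term t s v) ⟩
      ∑[ t < suc k ] ∑[ v < n ] ∑[ s < suc ℓ ] term t s v
        ≡⟨ ∑ℚ.sum-cong-≗ {suc k} (λ t → ∑ℚ.∑-comm (λ v s → term t s v)) ⟩
      ∑[ t < suc k ] ∑[ s < suc ℓ ] ∑[ v < n ] term t s v
        ≡⟨ ∑ℚ.sum-cong-≗ {suc k} (λ t → ∑ℚ.sum-cong-≗ {suc ℓ} (λ s →
             trans (monomial-represents (exponent<n t s) per u) (cong f (reorder (toℕ t) (toℕ s))))) ⟩
      ∑[ t < suc k ] ∑[ s < suc ℓ ] f (toℕ u + i + toℕ t * j + toℕ s * 1)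
        ≡⟨ ∑ℚ.sum-cong-≗ {suc k} (λ t → geom-sum (suc ℓ) 1 f (toℕ u + i + toℕ t * j)) ⟨
      ∑[ t < suc k ] ⟦ geom (suc ℓ) 1 ⟧ f (toℕ u + i + toℕ t * j)
        ≡⟨ geom-sum (suc k) j (⟦ geom (suc ℓ) 1 ⟧ f) (toℕ u + i) ⟨
      ⟦ factored ⟧ f (toℕ u)  ∎
      where
      open ≡-Reasoning
      coeff : Fin (suc k) → Fin (suc ℓ) → Fin n → ℕ
      coeff t s v = (x^ (i + toℕ s + toℕ t * j)) (offset u v)

      term : Fin (suc k) → Fin (suc ℓ) → Fin n → ℚ
      term t s v = ι (coeff t s v) ℚ.* f (toℕ v)

      reorder : ∀ t s → toℕ u + (i + s + t * j) ≡ toℕ u + i + t * j + s * 1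
      reorder t s = solve 4 (λ u i s y → u :+ (i :+ s :+ y) := u :+ i :+ y :+ s :* con 1) refl
                      (toℕ u) i s (t * j)
        where open ℕ.+-*-Solver

      entry : ∀ v → ι (adjacency (C n i j k ℓ) u v) ℚ.* f (toℕ v)
                  ≡ ∑[ t < suc k ] ∑[ s < suc ℓ ] term t s v
      entry v = begin
        ι (adjacency (C n i j k ℓ) u v) ℚ.* f (toℕ v)
          ≡⟨ cong (λ m → ι m ℚ.* f (toℕ v)) (adjacency≡C-poly u v) ⟩
        ι (C-poly i j k ℓ (offset u v)) ℚ.* f (toℕ v)
          ≡⟨ cong (ℚ._* f (toℕ v)) (ι-sum {suc k} (λ t → ∑ℕ.sum {suc ℓ} (λ s → coeff t s v))) ⟩
        ∑[ t < suc k ] ι (∑ℕ.sum {suc ℓ} (λ s → coeff t s v)) ℚ.* f (toℕ v)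
          ≡⟨ ∑ℚ.*-distribʳ-sum {suc k} (f (toℕ v)) (λ t → ι (∑ℕ.sum {suc ℓ} (λ s → coeff t s v))) ⟩
        ∑[ t < suc k ] (ι (∑ℕ.sum {suc ℓ} (λ s → coeff t s v)) ℚ.* f (toℕ v))
          ≡⟨ ∑ℚ.sum-cong-≗ {suc k} (λ t → trans
               (cong (ℚ._* f (toℕ v)) (ι-sum {suc ℓ} (λ s → coeff t s v)))
               (∑ℚ.*-distribʳ-sum {suc ℓ} (f (toℕ v)) (λ s → ι (coeff t s v)))) ⟩
        ∑[ t < suc k ] ∑[ s < suc ℓ ] term t s v  ∎

-- The gcd conditions.

gcd≥2⊎coprime : ∀ m n .{{_ : NonZero m}} → gcd m n ≥ 2 ⊎ Coprime m n
-- Abstracting over the `NonZero` proof too rules out the case of gcd 0.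
gcd≥2⊎coprime m n with gcd m n in eq | gcd-nonZeroˡ m n
... | 1           | _ = inj₂ (gcd≡1⇒coprime eq)
... | suc (suc _) | _ = inj₁ (s≤s (s≤s z≤n))

theorem25 : (n : ℕ) .{{_ : NonZero n}} (i j k ℓ : ℕ) → ℓ < j → k * j + i + ℓ < n →
    Singular (C n i j k ℓ) ⇔
    (gcd (ℓ + 1) n ≥ 2 ⊎ gcd (k + 1) ((n / gcd n j) {{gcd-nonZeroˡ n j}}) ≥ 2)
theorem25 n i j k ℓ ℓ<j deg rewrite +-comm ℓ 1 | +-comm k 1 = mk⇔ singular⇒ singular⇐
  where
  instance
    g≢0 : NonZero (gcd n j)
    g≢0 = gcd-nonZeroˡ n j

  -- `N` is the order of j modulo n, so y = xʲ satisfies y^N = 1.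
  g N : ℕ
  g = gcd n j
  N = n / g

  A : Matrix ℚ n
  A u v = ι (adjacency (C n i j k ℓ) u v)

  Gₖ Gₗ : Operator
  Gₖ = geom (suc k) j
  Gₗ = geom (suc ℓ) 1

  represents : Represents A (shift i ⊗ (Gₖ ⊗ Gₗ))
  represents = adjacency-represents i j k ℓ ℓ<j deg

  N*g≡n : N * g ≡ n
  N*g≡n = m/n*n≡m (gcd[m,n]∣m n j)

  n∣N*j : n ∣ N * j
  n∣N*j = subst (_∣ N * j) N*g≡n (*-monoʳ-∣ N (gcd[m,n]∣n n j))

  i≤n : i ≤ n
  i≤n = <⇒≤ (≤-<-trans (≤-trans (m≤n+m i (k * j)) (m≤m+n (k * j + i) ℓ)) deg)

  singular⇒ : Singular (C n i j k ℓ) → gcd (suc ℓ) n ≥ 2 ⊎ gcd (suc k) N ≥ 2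
  singular⇒ singular with gcd≥2⊎coprime (suc ℓ) n | gcd≥2⊎coprime (suc k) N
  ... | inj₁ ≥2  | _        = inj₁ ≥2
  ... | inj₂ _   | inj₁ ≥2  = inj₂ ≥2
  ... | inj₂ ℓ⊥n | inj₂ k⊥N = contradiction (hasInverse⇒invertible A (shift i ⊗ (Gₖ ⊗ Gₗ)) represents
    (⊗-hasInverse (shift i) (Gₖ ⊗ Gₗ) (shift-hasInverse i≤n)
      (⊗-hasInverse Gₖ Gₗ (geom-hasInverse (suc k) j N n∣N*j k⊥N)
                          (geom-hasInverse (suc ℓ) 1 n (m∣m*n 1) ℓ⊥n)))) singular

  singular⇐ : gcd (suc ℓ) n ≥ 2 ⊎ gcd (suc k) N ≥ 2 → Singular (C n i j k ℓ)
  -- Here y = x and D = gcd(ℓ+1, n), which exceeds 1 and so does not divide the step 1.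
  singular⇐ (inj₁ d≥2) = hasKernel⇒singular A (shift i ⊗ (Gₖ ⊗ Gₗ)) represents
    (⊗-hasKernelʳ (shift i) (Gₖ ⊗ Gₗ) (⊗-hasKernelʳ Gₖ Gₗ
      (geom-hasKernel (suc ℓ) 1 (gcd (suc ℓ) n) (gcd[m,n]∣n (suc ℓ) n)
        (∣m⇒∣m*n 1 (gcd[m,n]∣m (suc ℓ) n)) (>⇒∤ d≥2))))
  -- Here y = xʲ and D = dg. It divides n = Ng because d divides N, and (k+1)j because d divides k+1
  -- and g divides j.
  singular⇐ (inj₂ d≥2) = hasKernel⇒singular A (shift i ⊗ (Gₖ ⊗ Gₗ)) represents
    (⊗-hasKernelʳ (shift i) (Gₖ ⊗ Gₗ) (⊗-hasKernelˡ Gₖ Gₗ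
      (geom-hasKernel (suc k) j (d * g) dg∣n
        (*-pres-∣ (gcd[m,n]∣m (suc k) N) (gcd[m,n]∣n n j)) dg∤j)))
    where
    d : ℕ
    d = gcd (suc k) N

    dg∣n : d * g ∣ n
    dg∣n = subst (d * g ∣_) N*g≡n (*-monoˡ-∣ g (gcd[m,n]∣n (suc k) N))

    dg∤j : d * g ∤ j
    -- If dg divided j, it would be a common divisor of n and j and so divide g, forcing d = 1.
    dg∤j dg∣j = contradiction (∣1⇒≡1 (*-cancelʳ-∣ g (subst (d * g ∣_) (sym (*-identityˡ g))
      (gcd-greatest dg∣n dg∣j)))) λ d≡1 → <⇒≢ d≥2 (sym d≡1)
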